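{- For every modal formula $A$: 1. if $\varnothing\vdash A$ then $A$ is valid in every frame; 2. if $\mathcal{D}\vdash A$ then $A$ is valid in every serial frame; 3. if $\mathcal{T}\vdash A$ then $A$ is valid in every reflexive frame; 4. if $\mathcal{K}4\vdash A$ then $A$ is valid in every transitive frame; 5. if $\mathcal{S}4\vdash A$ then $A$ is valid in every reflexive transitive frame; 6. if $\mathcal{B}\vdash A$ then $A$ is valid in every reflexive symmetric frame; 7. if $\mathcal{S}5\vdash A$ then $A$ is valid in every reflexive euclidean frame; 8. if $\mathcal{GL}\vdash A$ then $A$ is valid in every transitive converse well-founded frame.
   Context: Syntax. Modal formulas are generated from a countably infinite set $\Phi$ of propositional atoms by $A ::= \bot \mid p \mid A\to B \mid \Box A$ ($p\in\Phi$). Abbreviations: $\top:=\bot\to\bot$, $\neg A:=A\to\bot$, $A\lor B:=\neg A\to B$, $A\land B:=\neg(\neg A\lor\neg B)$, $\Diamond A:=\neg\Box\neg A$. Semantics. A frame is a pair $\langle W,R\rangle$ with $W$ a nonempty set and $R\subseteq W\times W$. A model based on it is $\mathcal{M}=\langle W,R,V\rangle$ with $V\subseteq\Phi\times W$. Forcing: $\mathcal{M},w\vDash p$ iff $pVw$; $\mathcal{M},w\not\vDash\bot$; $\mathcal{M},w\vDash B\to C$ iff $\mathcal{M},w\not\vDash B$ or $\mathcal{M},w\vDash C$; $\mathcal{M},w\vDash\Box B$ iff $\mathcal{M},x\vDash B$ for all $x\in W$ with $wRx$. $A$ is valid in $\langle W,R\rangle$ if $\mathcal{M},w\vDash A$ for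 every model $\mathcal{M}$ based on $\langle W,R\rangle$ and every $w\in W$. Frame properties. A frame has a property iff $R$ does. Serial: $\forall w\exists y\,(wRy)$; euclidean: $\forall w,x,y\,(wRx$ and $wRy\Rightarrow yRx)$; converse well-founded: every nonempty $X\subseteq W$ contains some $w$ with no $x\in X$ such that $wRx$. Deducibility. The axioms of the minimal calculus $\mathsf{K}$ are all instances of a fixed complete set of schemata for classical propositional logic and of $\Box(A\to B)\to(\Box A\to\Box B)$. For a set $\mathcal{S}$ of axiom schemata (identified with the set of its instances), $\mathcal{S}\vdash A$ means that $A$ belongs to the smallest set of formulas containing the axioms of $\mathsf{K}$ and all instances of schemata in $\mathcal{S}$, and closed under modus ponens (from $B\to A$ and $B$ infer $A$) and necessitation (from $A$ infer $\Box A$). Schemata: $\mathbf{D}:\Box A\to\Diamond A$; $\mathbf{T}:\Box A\to A$; $\mathbf{4}:\Box A\to\Box\Box A$; $\mathbf{B}:A\to\Box\Diamond A$; $\mathbf{5}:\Diamond A\to\Box\Diamond A$; $\mathbf{GL}:\Box(\Box A\to A)\to\Box A$. Sets: $\mathcal{D}=\{\mathbf{D}\}$, $\mathcal{T}=\{\mathbf{T}\}$, $\mathcal{K}4=\{\mathbf{4}\}$, $\mathcal{S}4=\{\mathbf{T},\mathbf{4}\}$, $\mathcal{B}=\{\mathbf{T},\mathbf{B}\}$, $\mathcal{S}5=\{\mathbf{T},\mathbf{5}\}$, $\mathcal{GL}=\{\mathbf{GL}\}$. -}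

module Defs where

open import Data.Empty.Polymorphic using () renaming (⊥ to Empty)
open import Data.Nat.Base using (ℕ)
open import Data.Product.Base using (∃-syntax; _×_)
open import Data.Sum.Base using (_⊎_)
open import Level using (Level; 0ℓ; suc)
open import Relation.Binary.Core using (Rel)
open import Relation.Binary.PropositionalEquality.Core using (_≡_)
open import Relation.Nullary.Negation.Core using (¬_)
open import Relation.Unary using (Pred; _∈_; _∪_; Satisfiable)

private variable
  ℓ : Level

Φ : Set
Φ = ℕ

infixr 20 _⇒_
infix  30 □_ ◇_ ~_

data Formula : Set where
  ⊥′  : Formula
  var : Φ → Formula
  _⇒_ : Formula → Formula → Formula
  □_  : Formula → Formula

~_ : Formula → Formula
~ A = A ⇒ ⊥′

◇_ : Formula → Formula
◇ A = ~ □ ~ A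

record Frame ℓ : Set (suc ℓ) where
  field
    W        : Set ℓ
    R        : Rel W ℓ
    nonempty : W

record Model ℓ : Set (suc ℓ) where
  field
    frame : Frame ℓ
  open Frame frame public
  field
    V : Φ → W → Set ℓ

-- The clause for ⇒ is the classical one, a disjunction rather than a
-- function space; the two agree under excluded middle.
infix 4 _,_⊨_
_,_⊨_ : (M : Model ℓ) → Model.W M → Formula → Set ℓ
M , w ⊨ ⊥′      = Empty
M , w ⊨ var p   = Model.V M p w
M , w ⊨ (B ⇒ C) = (¬ (M , w ⊨ B)) ⊎ (M , w ⊨ C)
M , w ⊨ □ B     = ∀ x → Model.R M w x → M , x ⊨ B

infix 4 _ValidIn_
_ValidIn_ : Formula → Frame ℓ → Set (suc ℓ)
_ValidIn_ {ℓ} A F =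
  (V : Φ → Frame.W F → Set ℓ) (w : Frame.W F) → record { frame = F ; V = V } , w ⊨ A

Serial : {W : Set ℓ} → Rel W ℓ → Set ℓ
Serial _R_ = ∀ w → ∃[ y ] w R y

Euclidean : {W : Set ℓ} → Rel W ℓ → Set ℓ
Euclidean _R_ = ∀ {w x y} → w R x → w R y → y R x

ConverseWellFounded : {W : Set ℓ} → Rel W ℓ → Set (suc ℓ)
ConverseWellFounded {ℓ} {W} _R_ =
  (X : Pred W ℓ) → Satisfiable X → ∃[ w ] w ∈ X × ¬ (∃[ x ] x ∈ X × w R x)

-- A schema, or a set of schemata, is identified with the set of its instances.
Schemata : Set₁
Schemata = Pred Formula 0ℓ

-- ax-k, ax-s and ax-dne are Church's schemata, complete (with modus ponens)
-- for classical propositional logic over ⊥ and ⇒.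
infix 3 _⊢_
data _⊢_ (𝒮 : Schemata) : Formula → Set where
  ax-k   : ∀ {A B} → 𝒮 ⊢ A ⇒ B ⇒ A
  ax-s   : ∀ {A B C} → 𝒮 ⊢ (A ⇒ B ⇒ C) ⇒ (A ⇒ B) ⇒ A ⇒ C
  ax-dne : ∀ {A} → 𝒮 ⊢ ~ ~ A ⇒ A
  ax-K   : ∀ {A B} → 𝒮 ⊢ □ (A ⇒ B) ⇒ □ A ⇒ □ B
  ax-𝒮   : ∀ {A} → A ∈ 𝒮 → 𝒮 ⊢ A
  mp     : ∀ {A B} → 𝒮 ⊢ B ⇒ A → 𝒮 ⊢ B → 𝒮 ⊢ A
  nec    : ∀ {A} → 𝒮 ⊢ A → 𝒮 ⊢ □ A

schema : (Formula → Formula) → Schemata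
schema f B = ∃[ A ] B ≡ f A

ax-D ax-T ax-4 ax-B ax-5 ax-GL : Schemata
ax-D  = schema λ A → □ A ⇒ ◇ A
ax-T  = schema λ A → □ A ⇒ A
ax-4  = schema λ A → □ A ⇒ □ □ A
ax-B  = schema λ A → A ⇒ □ ◇ A
ax-5  = schema λ A → ◇ A ⇒ □ ◇ A
ax-GL = schema λ A → □ (□ A ⇒ A) ⇒ □ A

𝒟 𝒯 𝒦4 𝒮4 ℬ 𝒮5 𝒢ℒ : Schemata
𝒟  = ax-D
𝒯  = ax-T
𝒦4 = ax-4
𝒮4 = ax-T ∪ ax-4
ℬ  = ax-T ∪ ax-B
𝒮5 = ax-T ∪ ax-5
𝒢ℒ = ax-GL

{-# OPTIONS --safe #-}
module Submission where

open import Defs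
open import Axiom.ExcludedMiddle using (ExcludedMiddle)
open import Data.Product.Base using (_×_; _,_)
open import Data.Sum.Base using (inj₁; inj₂; [_,_]′)
open import Level using (Level; lower; suc)
open import Relation.Binary.Definitions using (Reflexive; Symmetric; Transitive)
open import Relation.Binary.PropositionalEquality.Core using (refl)
open import Relation.Nullary.Decidable.Core using (yes; no; decidable-stable)
open import Relation.Nullary.Negation.Core using (¬_; contradiction)
open import Relation.Unary using (∅; _∈_; _∪_)
open Frame using (R)

private variable
  ℓ : Level
  𝒮 𝒮′ : Schemata

-- For a fixed frame, the valid formulas contain the axioms of `K` and are closed under modus ponens
-- and necessitation. Once the frame validates every instance of `𝒮`, it therefore validates
-- everything derivable from `𝒮`; this is `soundness`. What remains is one frame computation per
-- schema, from `D-valid` to `GL-valid`, with `∪-valid` combining two schemata. Excluded middle lets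
-- the disjunctive clause for `⇒` be handled as ordinary implication.

model : (F : Frame ℓ) → (Φ → Frame.W F → Set ℓ) → Model ℓ
model F V = record { frame = F ; V = V }

infix 4 _Validates_
_Validates_ : Frame ℓ → Schemata → Set (suc ℓ)
F Validates 𝒮 = ∀ A → A ∈ 𝒮 → A ValidIn F

∪-valid : (F : Frame ℓ) → F Validates 𝒮 → F Validates 𝒮′ → F Validates 𝒮 ∪ 𝒮′
∪-valid F 𝒮-valid 𝒮′-valid A = [ 𝒮-valid A , 𝒮′-valid A ]′

module Forcing (em : ExcludedMiddle ℓ) (M : Model ℓ) where
  ⊨-stable : ∀ A {w} → ¬ ¬ (M , w ⊨ A) → M , w ⊨ A
  ⊨-stable A = decidable-stable em

  -- The disjunctive clause requires committing to one side, so excluded middle decides whether `A`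
  -- is forced at `w`.
  ⇒-intro : ∀ A B {w} → (M , w ⊨ A → M , w ⊨ B) → M , w ⊨ A ⇒ B
  ⇒-intro A B {w} f with em {M , w ⊨ A}
  ... | yes a = inj₂ (f a)
  ... | no ¬a = inj₁ ¬a

  ⇒-elim : ∀ A B {w} → M , w ⊨ A ⇒ B → M , w ⊨ A → M , w ⊨ B
  ⇒-elim A B (inj₁ ¬a) a = contradiction a ¬a
  ⇒-elim A B (inj₂ b)  _ = b

  ~-elim : ∀ A {w} → M , w ⊨ ~ A → ¬ (M , w ⊨ A)
  ~-elim A h a = lower (⇒-elim A ⊥′ h a)

  -- As `◇ A` abbreviates `~ □ ~ A`, it suffices to refute `□ ~ A` at `w`, and the successor `y`
  -- does so.
  ◇-intro : ∀ A {w y} → Model.R M w y → M , y ⊨ A → M , w ⊨ ◇ A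
  ◇-intro A wRy a = inj₁ λ □~a → ~-elim A (□~a _ wRy) a

module Soundness (em : ExcludedMiddle ℓ) (F : Frame ℓ) where
  -- Induction on the derivation, with the valuation and the world left arbitrary in the induction
  -- hypothesis.
  soundness : F Validates 𝒮 → F Validates (𝒮 ⊢_)
  soundness {𝒮} 𝒮-valid _ = sound
    where
    sound : ∀ {A} → 𝒮 ⊢ A → A ValidIn F
    sound (ax-k {A} {B}) V w =
      ⇒-intro A (B ⇒ A) λ a → inj₂ a
      where open Forcing em (model F V)
    sound (ax-s {A} {B} {C}) V w =
      ⇒-intro (A ⇒ B ⇒ C) ((A ⇒ B) ⇒ A ⇒ C) λ abc →
      ⇒-intro (A ⇒ B) (A ⇒ C) λ ab →
      ⇒-intro A C λ a →
      ⇒-elim B C (⇒-elim A (B ⇒ C) abc a) (⇒-elim A B ab a)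
      where open Forcing em (model F V)
    sound (ax-dne {A}) V w =
      ⇒-intro (~ ~ A) A λ ¬¬a → ⊨-stable A λ ¬a → ~-elim (~ A) ¬¬a (inj₁ ¬a)
      where open Forcing em (model F V)
    sound (ax-K {A} {B}) V w =
      ⇒-intro (□ (A ⇒ B)) (□ A ⇒ □ B) λ □ab →
      ⇒-intro (□ A) (□ B) λ □a x wRx →
      ⇒-elim A B (□ab x wRx) (□a x wRx)
      where open Forcing em (model F V)
    sound (ax-𝒮 A∈𝒮) V w = 𝒮-valid _ A∈𝒮 V w
    sound (mp {A} {B} d e) V w = ⇒-elim B A (sound d V w) (sound e V w)
      where open Forcing em (model F V)
    -- Validity covers all worlds, so the hypothesis applies at `x` directly, whether or not `w`
    -- sees it.
    sound (nec d) V w x _ = sound d V x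

  D-valid : Serial (R F) → F Validates ax-D
  D-valid serial _ (A , refl) V w =
    ⇒-intro (□ A) (◇ A) λ □a →
    let y , wRy = serial w in ◇-intro A wRy (□a y wRy)
    where open Forcing em (model F V)

  T-valid : Reflexive (R F) → F Validates ax-T
  T-valid rfl _ (A , refl) V w = ⇒-intro (□ A) A λ □a → □a w rfl
    where open Forcing em (model F V)

  4-valid : Transitive (R F) → F Validates ax-4
  4-valid trans _ (A , refl) V w =
    ⇒-intro (□ A) (□ □ A) λ □a x wRx y xRy → □a y (trans wRx xRy)
    where open Forcing em (model F V)

  B-valid : Symmetric (R F) → F Validates ax-B
  B-valid sym _ (A , refl) V w =
    -- By symmetry `x` sees `w`, so `w` itself is the witness for `◇ A` at `x`.
    ⇒-intro A (□ ◇ A) λ a x wRx → ◇-intro A (sym wRx) a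
    where open Forcing em (model F V)

  5-valid : Euclidean (R F) → F Validates ax-5
  5-valid eucl _ (A , refl) V w =
    -- By euclideanness `x` sees every successor of `w`, so `□ ~ A` at `x` would give `□ ~ A` at
    -- `w`, against `◇ A` there.
    ⇒-intro (◇ A) (□ ◇ A) λ ◇a x wRx → inj₁ λ □~a →
    ~-elim (□ ~ A) ◇a λ y wRy → □~a y (eucl wRy wRx)
    where open Forcing em (model F V)

  -- If A failed at a successor of w, it would fail at an R-maximal successor m
  -- of w; by transitivity m forces □ A, hence A.
  GL-valid : Transitive (R F) → ConverseWellFounded (R F) → F Validates ax-GL
  GL-valid trans cwf _ (A , refl) V w =
    ⇒-intro (□ (□ A ⇒ A)) (□ A) λ □[□a⇒a] x wRx → ⊨-stable A λ x⊭A →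
    let m , (wRm , m⊭A) , m-maximal =
          cwf (λ y → R F w y × ¬ (model F V , y ⊨ A)) (x , wRx , x⊭A)
    in m⊭A (⇒-elim (□ A) A (□[□a⇒a] m wRm) λ z mRz →
         ⊨-stable A λ z⊭A → m-maximal (z , (trans wRm mRz , z⊭A) , mRz))
    where open Forcing em (model F V)

theorem1p7p2 : ∀ {ℓ} → ExcludedMiddle ℓ → ∀ (A : Formula) →
    (∅ ⊢ A → ∀ (F : Frame ℓ) → A ValidIn F)
    × (𝒟 ⊢ A → ∀ (F : Frame ℓ) → Serial (R F) → A ValidIn F)
    × (𝒯 ⊢ A → ∀ (F : Frame ℓ) → Reflexive (R F) → A ValidIn F)
    × (𝒦4 ⊢ A → ∀ (F : Frame ℓ) → Transitive (R F) → A ValidIn F)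
    × (𝒮4 ⊢ A → ∀ (F : Frame ℓ) → Reflexive (R F) → Transitive (R F) → A ValidIn F)
    × (ℬ ⊢ A → ∀ (F : Frame ℓ) → Reflexive (R F) → Symmetric (R F) → A ValidIn F)
    × (𝒮5 ⊢ A → ∀ (F : Frame ℓ) → Reflexive (R F) → Euclidean (R F) → A ValidIn F)
    × (𝒢ℒ ⊢ A → ∀ (F : Frame ℓ) → Transitive (R F) → ConverseWellFounded (R F) → A ValidIn F)
theorem1p7p2 em A =
    (λ d F → let open Soundness em F in soundness (λ _ ()) A d)
  , (λ d F serial → let open Soundness em F in soundness (D-valid serial) A d)
  , (λ d F rfl → let open Soundness em F in soundness (T-valid rfl) A d)
  , (λ d F trans → let open Soundness em F in soundness (4-valid trans) A d)
  , (λ d F rfl trans → let open Soundness em F in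
       soundness (∪-valid F (T-valid rfl) (4-valid trans)) A d)
  , (λ d F rfl sym → let open Soundness em F in
       soundness (∪-valid F (T-valid rfl) (B-valid sym)) A d)
  , (λ d F rfl eucl → let open Soundness em F in
       soundness (∪-valid F (T-valid rfl) (5-valid eucl)) A d)
  , (λ d F trans cwf → let open Soundness em F in
       soundness (GL-valid trans cwf) A d)
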